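{- Let $G$ be a loopless graph. Then the neighbourhood-set system $(V(G),\mathcal{N}(G))$ is a maximum system if and only if $G$ is a nonempty set of isolated vertices (i.e. has no edges).
   Context: Graphs are finite, undirected, with nonempty vertex set and no multiple edges. $N_G(v)$ is the set of vertices adjacent to $v$, and $\mathcal{N}(G)=\{N_G(v):v\in V(G)\}$ (without multiplicities). For a set system $(X,\mathcal{F})$ ($X$ a finite set, $\mathcal{F}$ a nonempty family of distinct subsets of $X$) and $Y\subseteq X$, let $\mathcal{F}\cap Y=\{A\cap Y:A\in\mathcal{F}\}$; $Y$ is shattered if $\mathcal{F}\cap Y$ is the full power set of $Y$, and the VC-dimension is the largest size of a shattered set. The system, with VC-dimension $d$, is maximum if $|\mathcal{F}\cap Y|=\sum_{i=0}^d\binom{|Y|}{i}$ for every $Y\subseteq X$. -}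

module Defs where

open import Data.Bool.Properties as Bool using ()
open import Data.Fin.Base using (Fin)
open import Data.Fin.Subset using (Subset; _⊆_; _∩_; ∣_∣)
open import Data.List.Base using (List; []; _∷_; length; map; sum; upTo; allFin; deduplicate)
open import Data.List.Membership.Propositional using () renaming (_∈_ to _∈ˡ_)
open import Data.List.Relation.Unary.Unique.Propositional using (Unique)
open import Data.List.Relation.Unary.Unique.DecPropositional.Properties using (deduplicate-!)
open import Data.Nat.Base using (ℕ; suc; _≤_; NonZero)
open import Data.Nat.Combinatorics using (_C_)
open import Data.Product.Base using (∃-syntax; _×_)
open import Data.Vec.Base using (tabulate)
open import Data.Vec.Properties using (≡-dec)
open import Function.Bundles using (_⇔_)
open import Level using (0ℓ)
open import Relation.Binary.Core using (Rel)
open import Relation.Binary.Definitions using (Decidable; DecidableEquality; Symmetric)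
open import Relation.Binary.PropositionalEquality using (_≡_; _≢_)
open import Relation.Nullary using (¬_; does)

_≟ˢ_ : ∀ {n} → DecidableEquality (Subset n)
_≟ˢ_ = ≡-dec Bool._≟_

-- A set system on the ground set Fin n. The family is listed without
-- repetition, so its cardinality is the length of the list.
record SetSystem (n : ℕ) : Set where
  field
    family   : List (Subset n)
    nonempty : family ≢ []
    distinct : Unique family

  -- The family { A ∩ Y : A ∈ family }, again without repetition.
  trace : Subset n → List (Subset n)
  trace Y = deduplicate _≟ˢ_ (map (_∩ Y) family)

  Shattered : Subset n → Set
  Shattered Y = ∀ Z → (Z ∈ˡ trace Y) ⇔ (Z ⊆ Y)

  -- The empty set is always shattered, since the family is nonempty; hence
  -- exactly one d satisfies this.
  IsVCDimension : ℕ → Set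
  IsVCDimension d =
    (∃[ Y ] Shattered Y × ∣ Y ∣ ≡ d) × (∀ Y → Shattered Y → ∣ Y ∣ ≤ d)

  Maximum : Set
  Maximum = ∃[ d ] IsVCDimension d ×
    (∀ Y → length (trace Y) ≡ sum (map (∣ Y ∣ C_) (upTo (suc d))))

-- Loops are allowed here; see Loopless.
record Graph (n : ℕ) : Set₁ where
  infix 4 _∼_ _∼?_
  field
    nonempty : NonZero n
    _∼_      : Rel (Fin n) 0ℓ
    _∼?_     : Decidable _∼_
    ∼-sym    : Symmetric _∼_

  Loopless : Set
  Loopless = ∀ v → ¬ (v ∼ v)

  Isolated : Fin n → Set
  Isolated v = ∀ w → ¬ (v ∼ w)

  N : Fin n → Subset n
  N v = tabulate (λ w → does (v ∼? w))

  neighbourhoods : List (Subset n)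
  neighbourhoods = deduplicate _≟ˢ_ (map N (allFin n))

  private
    neighbourhoods≢[] : neighbourhoods ≢ []
    neighbourhoods≢[] = lemma nonempty N
      where
      lemma : ∀ {m k} → NonZero m → (f : Fin m → Subset k) →
              deduplicate _≟ˢ_ (map f (allFin m)) ≢ []
      lemma {suc _} _ f ()

  neighbourhoodSystem : SetSystem n
  neighbourhoodSystem = record
    { family   = neighbourhoods
    ; nonempty = neighbourhoods≢[]
    ; distinct = deduplicate-! _≟ˢ_ (map N (allFin n))
    }

{-# OPTIONS --safe #-}

-- A graph on n vertices has at most n neighbourhoods, whereas a maximum system
-- of VC-dimension d ≥ 1 has at least 1 + n members (take Y to be the ground
-- set).  So d = 0 and there is a single neighbourhood; if v ∼ w, then
-- w ∈ N v = N w is a loop.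

module Submission where

open import Defs
open import Data.Empty using () renaming (⊥-elim to absurd)
open import Data.Fin.Subset using (_∈_; _⊆_; _∩_; ∣_∣; ⊤; ⊥)
open import Data.Fin.Subset.Properties
  using (∩-identityʳ; ∩-zeroʳ; ∣⊤∣≡n; ∣⊥∣≡0; ∉⊥; ⊆-refl; ⊆-reflexive; ⊆-min; Empty-unique)
open import Data.List.Base using (List; []; _∷_; length; map; upTo; allFin)
open import Data.List.Membership.Propositional using () renaming (_∈_ to _∈ˡ_)
open import Data.List.Membership.Propositional.Properties
  using (∈-map⁺; ∈-map⁻; ∈-allFin; ∈-deduplicate⁺; ∈-deduplicate⁻)
open import Data.List.Properties using (length-deduplicate; length-map; length-tabulate)
open import Data.List.Relation.Unary.All using (_∷_)
open import Data.List.Relation.Unary.Any using (here; there)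
open import Data.List.Relation.Unary.Unique.Propositional using (Unique; _∷_)
open import Data.List.Relation.Unary.Unique.DecPropositional.Properties using (deduplicate-!)
open import Data.Nat.Base using (ℕ; zero; suc; _+_; _≤_; s≤s)
open import Data.Nat.Combinatorics using (_C_; nC1≡n)
open import Data.Nat.ListAction using (sum)
open import Data.Nat.Properties using (module ≤-Reasoning; ≤-reflexive; m≤m+n; 1+n≰n)
open import Data.Product.Base using (∃-syntax; _×_; _,_)
open import Data.Vec.Properties using ([]=⇒lookup; lookup⇒[]=; lookup∘tabulate)
open import Function.Bundles using (_⇔_; mk⇔; Equivalence)
open import Relation.Binary.PropositionalEquality
  using (_≡_; _≢_; refl; sym; trans; cong; subst; module ≡-Reasoning)
open import Relation.Nullary using (does; yes)
open import Relation.Nullary.Decidable using (dec-true)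

-- Phrased through membership so that it passes from a family to its traces and applies directly to
-- two given neighbourhoods. For a nonempty list without repetition it amounts to length 1.
Subsingleton : {A : Set} → List A → Set
Subsingleton xs = ∀ {x y} → x ∈ˡ xs → y ∈ˡ xs → x ≡ y

module _ {A : Set} where

  length≡1⇒subsingleton : {xs : List A} → length xs ≡ 1 → Subsingleton xs
  length≡1⇒subsingleton {_ ∷ []} _ (here refl) (here refl) = refl

  subsingleton⇒length≡1 : {xs : List A} → xs ≢ [] → Unique xs → Subsingleton xs → length xs ≡ 1
  subsingleton⇒length≡1 {[]}        ≢[] _                 _   = absurd (≢[] refl)
  subsingleton⇒length≡1 {_ ∷ []}    _   _                 _   = refl
  subsingleton⇒length≡1 {_ ∷ _ ∷ _} _   ((x≢y ∷ _) ∷ _) sub =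
    absurd (x≢y (sub (here refl) (there (here refl))))

  ≢[]⇒∃∈ : {xs : List A} → xs ≢ [] → ∃[ x ] x ∈ˡ xs
  ≢[]⇒∃∈ {[]}    ≢[] = absurd (≢[] refl)
  ≢[]⇒∃∈ {x ∷ _} _   = x , here refl

  ∈⇒≢[] : {xs : List A} {x : A} → x ∈ˡ xs → xs ≢ []
  ∈⇒≢[] () refl

-- The terms of index 0 and 1 are 1 and `n`, and the rest only add. The double `suc` guarantees that
-- both indices occur: the sum is the one for VC-dimension `suc d`, that is, for positive dimension.
1+n≤∑nCi : ∀ n d → suc n ≤ sum (map (n C_) (upTo (suc (suc d))))
1+n≤∑nCi n d = begin
  1 + n                    ≡⟨ cong suc (nC1≡n n) ⟨
  -- `n C 0` computes to 1, so `s≤s` removes it from both sides.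
  1 + n C 1                ≤⟨ s≤s (m≤m+n (n C 1) _) ⟩
  n C 0 + (n C 1 + _)      ∎
  where open ≤-Reasoning

module _ {n : ℕ} (S : SetSystem n) where
  open SetSystem S

  ∈-trace⁺ : ∀ {A} Y → A ∈ˡ family → (A ∩ Y) ∈ˡ trace Y
  ∈-trace⁺ Y A∈ = ∈-deduplicate⁺ _≟ˢ_ (∈-map⁺ (_∩ Y) A∈)

  ∈-trace⁻ : ∀ {Z} Y → Z ∈ˡ trace Y → ∃[ A ] A ∈ˡ family × Z ≡ A ∩ Y
  ∈-trace⁻ Y Z∈ = ∈-map⁻ (_∩ Y) (∈-deduplicate⁻ _≟ˢ_ _ Z∈)

  length-trace-≤ : ∀ Y → length (trace Y) ≤ length family
  length-trace-≤ Y = begin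
    length (trace Y)               ≤⟨ length-deduplicate _≟ˢ_ (map (_∩ Y) family) ⟩
    length (map (_∩ Y) family)     ≡⟨ length-map (_∩ Y) family ⟩
    length family                  ∎
    where open ≤-Reasoning

  maximum⇒subsingleton : length family ≤ n → Maximum → Subsingleton family
  -- In dimension 0 the binomial sum has the single term `∣ ⊤ ∣ C 0`, which is 1. So `trace ⊤` has
  -- one member, and intersecting with `⊤` changes no set.
  maximum⇒subsingleton _ (zero , _ , ∣trace∣≡) {A} {B} A∈ B∈ = begin
    A      ≡⟨ ∩-identityʳ A ⟨
    A ∩ ⊤  ≡⟨ length≡1⇒subsingleton (∣trace∣≡ ⊤) (∈-trace⁺ ⊤ A∈) (∈-trace⁺ ⊤ B∈) ⟩
    B ∩ ⊤  ≡⟨ ∩-identityʳ B ⟩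
    B      ∎
    where open ≡-Reasoning
  maximum⇒subsingleton ∣family∣≤n (suc d , _ , ∣trace∣≡) _ _ = absurd (1+n≰n (begin
    1 + n                                          ≤⟨ 1+n≤∑nCi n d ⟩
    sum (map (n C_) (upTo (suc (suc d))))          ≡⟨ cong (λ k → sum (map (k C_) (upTo (suc (suc d))))) (∣⊤∣≡n n) ⟨
    sum (map (∣ ⊤ {n} ∣ C_) (upTo (suc (suc d))))  ≡⟨ ∣trace∣≡ ⊤ ⟨
    length (trace ⊤)                               ≤⟨ length-trace-≤ ⊤ ⟩
    length family                                  ≤⟨ ∣family∣≤n ⟩
    n                                              ∎))
    where open ≤-Reasoning

  module _ (sub : Subsingleton family) where

    trace-subsingleton : ∀ Y → Subsingleton (trace Y)
    trace-subsingleton Y P∈ Q∈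
      with _ , A∈ , refl ← ∈-trace⁻ Y P∈ | _ , B∈ , refl ← ∈-trace⁻ Y Q∈
      = cong (_∩ Y) (sub A∈ B∈)

    -- The only subset of `⊥` is `⊥` itself, and it is realised as `A ∩ ⊥` for any member `A`, which
    -- exists because the family is nonempty.
    ⊥-shattered : Shattered ⊥
    ⊥-shattered Z = mk⇔ ⇒ ⇐
      where
      ⇒ : Z ∈ˡ trace ⊥ → Z ⊆ ⊥
      ⇒ Z∈ with B , _ , refl ← ∈-trace⁻ ⊥ Z∈ = ⊆-reflexive (∩-zeroʳ B)

      ⇐ : Z ⊆ ⊥ → Z ∈ˡ trace ⊥
      ⇐ Z⊆⊥ with A , A∈ ← ≢[]⇒∃∈ nonempty = subst (_∈ˡ trace ⊥)
        (trans (∩-zeroʳ A) (sym (Empty-unique λ (_ , z∈) → ∉⊥ (Z⊆⊥ z∈))))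
        (∈-trace⁺ ⊥ A∈)

    -- Shattering puts both `Y` and `⊥` into the trace on `Y`, where any two members coincide. This
    -- bounds the VC-dimension by 0.
    shattered⇒≡⊥ : ∀ {Y} → Shattered Y → Y ≡ ⊥
    shattered⇒≡⊥ {Y} sh = trace-subsingleton Y
      (Equivalence.from (sh Y) ⊆-refl) (Equivalence.from (sh ⊥) (⊆-min Y))

    subsingleton⇒maximum : Maximum
    subsingleton⇒maximum
      = 0
      , ((⊥ , ⊥-shattered , ∣⊥∣≡0 n)
        , λ Y sh → ≤-reflexive (trans (cong ∣_∣ (shattered⇒≡⊥ sh)) (∣⊥∣≡0 n)))
      -- For dimension 0 the required size is `∣ Y ∣ C 0`, which is 1 for every `Y`.
      , λ Y → subsingleton⇒length≡1
          (let _ , A∈ = ≢[]⇒∃∈ nonempty in ∈⇒≢[] (∈-trace⁺ Y A∈))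
          (deduplicate-! _≟ˢ_ (map (_∩ Y) family))
          (trace-subsingleton Y)

module _ {n : ℕ} (G : Graph n) where
  open Graph G hiding (nonempty)

  ∈-N⁺ : ∀ {v w} → v ∼ w → w ∈ N v
  ∈-N⁺ {v} {w} v∼w = lookup⇒[]= w (N v)
    (trans (lookup∘tabulate _ w) (dec-true (v ∼? w) v∼w))

  ∈-N⁻ : ∀ {v w} → w ∈ N v → v ∼ w
  -- Abstracting `v ∼? w` in the lookup equation as well makes the negative case read
  -- `false ≡ true`, so only `yes` remains.
  ∈-N⁻ {v} {w} w∈ with v ∼? w | trans (sym (lookup∘tabulate (λ u → does (v ∼? u)) w)) ([]=⇒lookup w∈)
  ... | yes v∼w | _ = v∼w

  N∈neighbourhoods : ∀ v → N v ∈ˡ neighbourhoods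
  N∈neighbourhoods v = ∈-deduplicate⁺ _≟ˢ_ (∈-map⁺ N (∈-allFin v))

  ∈-neighbourhoods⁻ : ∀ {A} → A ∈ˡ neighbourhoods → ∃[ v ] A ≡ N v
  ∈-neighbourhoods⁻ A∈ with v , _ , A≡Nv ← ∈-map⁻ N (∈-deduplicate⁻ _≟ˢ_ _ A∈) = v , A≡Nv

  length-neighbourhoods-≤ : length neighbourhoods ≤ n
  length-neighbourhoods-≤ = begin
    length neighbourhoods      ≤⟨ length-deduplicate _≟ˢ_ (map N (allFin n)) ⟩
    length (map N (allFin n))  ≡⟨ length-map N (allFin n) ⟩
    length (allFin n)          ≡⟨ length-tabulate (λ v → v) ⟩
    n                          ∎
    where open ≤-Reasoning

  isolated⇒N≡⊥ : ∀ {v} → Isolated v → N v ≡ ⊥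
  isolated⇒N≡⊥ isolated = Empty-unique λ (w , w∈) → isolated w (∈-N⁻ w∈)

  -- Without edges every neighbourhood is `⊥`, so any two members of the family agree. This feeds
  -- the converse direction, through `subsingleton⇒maximum`.
  isolated⇒subsingleton : (∀ v → Isolated v) → Subsingleton neighbourhoods
  isolated⇒subsingleton isolated A∈ B∈
    with v , refl ← ∈-neighbourhoods⁻ A∈ | w , refl ← ∈-neighbourhoods⁻ B∈
    = trans (isolated⇒N≡⊥ (isolated v)) (sym (isolated⇒N≡⊥ (isolated w)))

  subsingleton⇒isolated : Loopless → Subsingleton neighbourhoods → ∀ v → Isolated v
  subsingleton⇒isolated loopless sub v w v∼w = loopless w
    (∈-N⁻ (subst (w ∈_) (sub (N∈neighbourhoods v) (N∈neighbourhoods w)) (∈-N⁺ v∼w)))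

corollary5p9 : ∀ (n : ℕ) (G : Graph n) → Graph.Loopless G →
    SetSystem.Maximum (Graph.neighbourhoodSystem G) ⇔ (∀ v → Graph.Isolated G v)
corollary5p9 n G loopless = mk⇔
  (λ maximum → subsingleton⇒isolated G loopless
    (maximum⇒subsingleton (Graph.neighbourhoodSystem G) (length-neighbourhoods-≤ G) maximum))
  (λ isolated → subsingleton⇒maximum (Graph.neighbourhoodSystem G) (isolated⇒subsingleton G isolated))
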